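{- Let $(\Sigma,A)$ be a finitary algebra whose underlying set $A$ is finite. Then the following are equivalent: (1) $(\Sigma^A)^{\perp\perp(\aleph_0)} = \langle \Sigma^A\rangle_{\aleph_0}$; (2) for every finitary operation $f:A^n \rightarrow A$, if $f \notin \langle \Sigma^A\rangle_{\aleph_0}$ then there exists some $\Sigma$-homomorphism $h:A^{(A^n)} \rightarrow A$ such that $h(f) \neq f\bigl((h(\pi_i))_{i \in n}\bigr)$, where $\pi_i:A^n\to A$ $(i\in n)$ denote the projections.
   Context: A finitary operation on a set $A$ is a map $A^n\to A$ with $n$ a finite cardinal ($n=\{0,\dots,n-1\}$; $n=0$ is allowed). A finitary signature is a set $\Sigma$ with an assignment of a finite cardinal, its arity, to each $\sigma\in\Sigma$. A $\Sigma$-algebra is a set $A$ equipped with an operation $\sigma^A:A^n\to A$ for each $\sigma\in\Sigma$, where $n$ is the arity of $\sigma$; a $\Sigma$-homomorphism is a map preserving these basic operations. A finitary algebra is a pair $(\Sigma,A)$ of a finitary signature $\Sigma$ and a $\Sigma$-algebra $A$; write $\Sigma^A=\{\sigma^A\mid\sigma\in\Sigma\}$. Each power $A^Y$ is a $\Sigma$-algebra under the pointwise operations; in particular $A^{(A^n)}$ is a $\Sigma$-algebra. A finitary clone on $A$ is a set $F$ of finitary operations on $A$ that contains all projections $\pi_i:A^n\to A$ and is such that for every $f:A^m\to A$ in $F$ and every family $g_j:A^n\to A$ $(j\in m)$ in $F$, the composite $f\circ(g_j)_{j\in m}:A^n\to A$ lies in $F$. $\langle\Sigma^A\rangle_{\aleph_0}$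 (the clone of finitary derived operations) is the smallest finitary clone on $A$ containing $\Sigma^A$. Operations $f:A^n\to A$ and $g:A^m\to A$ commute, written $f\perp g$, if for every matrix $a=(a_{ij})\in A^{n\times m}$ one has $g\bigl((f((a_{ij})_{i\in n}))_{j\in m}\bigr)=f\bigl((g((a_{ij})_{j\in m}))_{i\in n}\bigr)$. For a set $G$ of finitary operations on $A$, $G^{\perp(\aleph_0)}$ is the set of all finitary operations $f$ on $A$ with $f\perp g$ for all $g\in G$, and $G^{\perp\perp(\aleph_0)}$ is the result of applying $(-)^{\perp(\aleph_0)}$ twice to $G$. In $h(f)$, the map $f:A^n\to A$ is regarded as an element of $A^{(A^n)}$. -}

module Defs where

open import Data.Fin.Base using (Fin)
open import Data.Nat.Base using (ℕ)
open import Data.Product using (Σ; Σ-syntax; ∃-syntax; _,_)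
open import Data.Vec.Functional.Relation.Binary.Equality.Setoid using (≋-setoid)
open import Function.Bundles using (Func; Inverse; _⟨$⟩_)
import Function.Relation.Binary.Setoid.Equality as FunctionSpace
open import Level using (Level; _⊔_; suc)
open import Relation.Binary.Bundles using (Setoid)
import Relation.Binary.PropositionalEquality as ≡
open import Relation.Unary using (Pred; _∈_; _⊆_)

private
  variable
    a b y ℓ ℓ₁ ℓ₂ p q s : Level

-- Sets are setoids, maps are `Func`s, and equality of maps is pointwise, so
-- that function spaces such as A^(A^n) are extensional without any axiom.

infix 8 _^_

-- A^n : n-tuples are plain functions out of Fin n.
_^_ : Setoid a ℓ → ℕ → Setoid a ℓ
A ^ n = ≋-setoid A n

-- A^Y for an arbitrary set Y.
Power : Setoid a ℓ₁ → Setoid y ℓ₂ → Setoid (a ⊔ ℓ₁ ⊔ y ⊔ ℓ₂) (y ⊔ ℓ₁)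
Power A Y = FunctionSpace.setoid Y A

IsFinite : Setoid a ℓ → Set (a ⊔ ℓ)
IsFinite A = ∃[ k ] Inverse (≡.setoid (Fin k)) A

module Operations (A : Setoid a ℓ) where

  open Setoid A using (Carrier; _≈_)

  Op : ℕ → Set (a ⊔ ℓ)
  Op n = Func (A ^ n) A

  infix 4 _≈ₒ_

  _≈ₒ_ : ∀ {n} → Op n → Op n → Set (a ⊔ ℓ)
  _≈ₒ_ {n} = Setoid._≈_ (Power A (A ^ n))

  FinitaryOp : Set (a ⊔ ℓ)
  FinitaryOp = Σ ℕ Op

  π : ∀ {n} → Fin n → Op n
  π i = record { to = λ x → x i ; cong = λ x≈y → x≈y i }

  compose : ∀ {m n} → Op m → (Fin m → Op n) → Op n
  compose f g = record
    { to   = λ x → f ⟨$⟩ (λ j → g j ⟨$⟩ x)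
    ; cong = λ x≈y → Func.cong f (λ j → Func.cong (g j) x≈y)
    }

  -- `respects` says that F is a subset of the set of operations modulo
  -- pointwise equality.
  record IsClone (F : Pred FinitaryOp p) : Set (a ⊔ ℓ ⊔ p) where
    field
      respects   : ∀ {n} {f g : Op n} → f ≈ₒ g → (n , f) ∈ F → (n , g) ∈ F
      projection : ∀ {n} (i : Fin n) → (n , π i) ∈ F
      composite  : ∀ {m n} {f : Op m} {g : Fin m → Op n} →
                   (m , f) ∈ F → (∀ j → (n , g j) ∈ F) →
                   (n , compose f g) ∈ F

  data Clone⟨_⟩ (G : Pred FinitaryOp p) : Pred FinitaryOp (a ⊔ ℓ ⊔ p) where
    generator  : ∀ {f} → f ∈ G → f ∈ Clone⟨ G ⟩
    respects   : ∀ {n} {f g : Op n} → f ≈ₒ g →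
                 (n , f) ∈ Clone⟨ G ⟩ → (n , g) ∈ Clone⟨ G ⟩
    projection : ∀ {n} (i : Fin n) → (n , π i) ∈ Clone⟨ G ⟩
    composite  : ∀ {m n} {f : Op m} {g : Fin m → Op n} →
                 (m , f) ∈ Clone⟨ G ⟩ → (∀ j → (n , g j) ∈ Clone⟨ G ⟩) →
                 (n , compose f g) ∈ Clone⟨ G ⟩

  -- Clone⟨ G ⟩ is the smallest clone containing G.

  Clone-isClone : {G : Pred FinitaryOp p} → IsClone Clone⟨ G ⟩
  Clone-isClone = record
    { respects = respects ; projection = projection ; composite = composite }

  Clone-least : {G : Pred FinitaryOp p} {F : Pred FinitaryOp q} →
                IsClone F → G ⊆ F → Clone⟨ G ⟩ ⊆ F
  Clone-least F-clone G⊆F (generator f∈G)   = G⊆F f∈G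
  Clone-least F-clone G⊆F (respects f≈g f∈) =
    IsClone.respects F-clone f≈g (Clone-least F-clone G⊆F f∈)
  Clone-least F-clone G⊆F (projection i)    = IsClone.projection F-clone i
  Clone-least F-clone G⊆F (composite f∈ g∈) =
    IsClone.composite F-clone (Clone-least F-clone G⊆F f∈)
                              (λ j → Clone-least F-clone G⊆F (g∈ j))

  Commute : FinitaryOp → FinitaryOp → Set (a ⊔ ℓ)
  Commute (n , f) (m , g) = (x : Fin n → Fin m → Carrier) →
    g ⟨$⟩ (λ j → f ⟨$⟩ (λ i → x i j)) ≈ f ⟨$⟩ (λ i → g ⟨$⟩ (λ j → x i j))

  infix 9 _^⊥ _^⊥⊥

  _^⊥ : Pred FinitaryOp p → Pred FinitaryOp (a ⊔ ℓ ⊔ p)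
  (G ^⊥) f = ∀ g → g ∈ G → Commute f g

  _^⊥⊥ : Pred FinitaryOp p → Pred FinitaryOp (a ⊔ ℓ ⊔ p)
  G ^⊥⊥ = (G ^⊥) ^⊥

record Signature s : Set (suc s) where
  field
    Symbol : Set s
    arity  : Symbol → ℕ

record Algebra (S : Signature s) a ℓ : Set (s ⊔ suc (a ⊔ ℓ)) where
  open Signature S
  field
    setoid : Setoid a ℓ
    ⟦_⟧    : (σ : Symbol) → Func (setoid ^ arity σ) setoid

  open Setoid setoid public using (Carrier; _≈_)
  open Operations setoid public

  -- The set { σ^A | σ ∈ S } of basic operations.
  data Basic : Pred FinitaryOp (s ⊔ a ⊔ ℓ) where
    basic : ∀ σ {f : Op (arity σ)} → ⟦ σ ⟧ ≈ₒ f → (arity σ , f) ∈ Basic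

module _ {S : Signature s} where
  open Signature S

  IsHomomorphism : (𝔸 : Algebra S a ℓ₁) (𝔹 : Algebra S b ℓ₂) →
                   Func (Algebra.setoid 𝔸) (Algebra.setoid 𝔹) →
                   Set (s ⊔ a ⊔ ℓ₂)
  IsHomomorphism 𝔸 𝔹 h = (σ : Symbol) (x : Fin (arity σ) → 𝔸.Carrier) →
    h ⟨$⟩ (𝔸.⟦ σ ⟧ ⟨$⟩ x) 𝔹.≈ 𝔹.⟦ σ ⟧ ⟨$⟩ (λ i → h ⟨$⟩ x i)
    where
      module 𝔸 = Algebra 𝔸
      module 𝔹 = Algebra 𝔹

  Hom : Algebra S a ℓ₁ → Algebra S b ℓ₂ → Set (s ⊔ a ⊔ b ⊔ ℓ₁ ⊔ ℓ₂)
  Hom 𝔸 𝔹 = Σ[ h ∈ Func (Algebra.setoid 𝔸) (Algebra.setoid 𝔹) ]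
              IsHomomorphism 𝔸 𝔹 h

  powerAlgebra : Algebra S a ℓ₁ → (Y : Setoid y ℓ₂) →
                 Algebra S (a ⊔ ℓ₁ ⊔ y ⊔ ℓ₂) (y ⊔ ℓ₁)
  powerAlgebra 𝔸 Y = record
    { setoid = Power 𝔸.setoid Y
    ; ⟦_⟧    = λ σ → record
      { to   = λ f → record
        { to   = λ t → 𝔸.⟦ σ ⟧ ⟨$⟩ (λ i → f i ⟨$⟩ t)
        ; cong = λ t≈u → Func.cong 𝔸.⟦ σ ⟧ (λ i → Func.cong (f i) t≈u)
        }
      ; cong = λ f≈g t → Func.cong 𝔸.⟦ σ ⟧ (λ i → f≈g i t)
      }
    }
    where module 𝔸 = Algebra 𝔸

-- A homomorphism A^(A^n) → A and an m-ary operation g ∈ (Σ^A)^⊥ are the same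
-- data up to reindexing: a matrix x ∈ A^(n × m) turns g into
-- h(p) = g(j ↦ p(x_{-,j})), and then h(f) = f(h(π_i))_i is exactly the
-- commutation of f and g at x.  Conversely, A^n being finite, every h arises
-- in this way from a matrix whose columns enumerate A^n.  So f ∈ (Σ^A)^⊥⊥
-- iff h(f) = f(h(π_i))_i for every h.

module Submission where

open import Defs
open import Axiom.ExcludedMiddle using (ExcludedMiddle)
open import Data.Fin.Base using (Fin; combine; finToFun; funToFin)
open import Data.Fin.Properties using (finToFun-funToFin; funToFin-finToFin)
open import Data.Nat.Base as ℕ using (ℕ)
open import Data.Product using (Σ-syntax; _,_; proj₁; proj₂)
open import Function.Bundles using (_⇔_; _⟨$⟩_; Func; Inverse)
open import Level using (Level; _⊔_; Lift; lift; lower)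
open import Relation.Binary.Bundles using (Setoid)
open import Relation.Binary.PropositionalEquality as ≡ using (_≡_; _≗_)
open import Relation.Nullary using (¬_)
open import Relation.Nullary.Decidable using (decidable-stable; map′)
open import Relation.Unary using (Pred; _∈_; _∉_; _⊆_; _≐_)

private
  variable
    a ℓ p s : Level

funToFin-cong : ∀ {m n} {f g : Fin m → Fin n} → f ≗ g → funToFin f ≡ funToFin g
funToFin-cong {ℕ.zero}  f≗g = ≡.refl
funToFin-cong {ℕ.suc m} f≗g =
  ≡.cong₂ combine (f≗g Fin.zero) (funToFin-cong (λ i → f≗g (Fin.suc i)))

-- A tuple is coded by its entries' indices, read as the base-`k` digits of a number below `k ^ n`.
^-isFinite : (A : Setoid a ℓ) → IsFinite A → ∀ n → IsFinite (A ^ n)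
^-isFinite A (k , I) n = k ℕ.^ n , record
  { to        = λ c i → I.to (finToFun c i)
  ; from      = λ x → funToFin (λ i → I.from (x i))
  ; to-cong   = λ { ≡.refl i → A.refl }
  ; from-cong = λ x≈y → funToFin-cong (λ i → I.from-cong (x≈y i))
  ; inverse   =
      (λ { ≡.refl i → A.trans
             (I.to-cong (finToFun-funToFin _ i))
             (I.strictlyInverseˡ _) })
    , λ x≈ → ≡.trans
        (funToFin-cong (λ i → I.inverseʳ (x≈ i)))
        (funToFin-finToFin {n} {k} _)
  }
  where
  module A = Setoid A
  module I = Inverse I

module _ (A : Setoid a ℓ) where

  open Setoid A
  open Operations A

  -- For composites, `h` is moved past the outer `f` first, then past each inner `g j`.
  ⊥-isClone : (G : Pred FinitaryOp p) → IsClone (G ^⊥)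
  ⊥-isClone G = record
    { respects   = λ f≈f′ f∈ (_ , g) g∈ x →
        trans (Func.cong g (λ j → sym (f≈f′ _)))
              (trans (f∈ _ g∈ x) (f≈f′ _))
    ; projection = λ i g g∈ x → refl
    ; composite  = λ {_} {_} {f} f∈ g∈ h h∈ x →
        trans (f∈ h h∈ _) (Func.cong f (λ j → g∈ j h h∈ x))
    }

  -- Commutation is symmetric: transpose the matrix and reverse the equation.
  ⊆-⊥⊥ : (G : Pred FinitaryOp p) → G ⊆ G ^⊥⊥
  ⊆-⊥⊥ G f∈G g g∈ x = sym (g∈ _ f∈G (λ j i → x i j))

  Clone⊆⊥⊥ : (G : Pred FinitaryOp p) → Clone⟨ G ⟩ ⊆ G ^⊥⊥
  Clone⊆⊥⊥ G = Clone-least (⊥-isClone (G ^⊥)) (⊆-⊥⊥ G)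

module _ {S : Signature s} (𝔸 : Algebra S a ℓ) where

  open Algebra 𝔸
  open Setoid setoid using (refl; sym; trans)

  PreservedBy : ∀ {n} → Op n → Hom (powerAlgebra 𝔸 (setoid ^ n)) 𝔸 → Set ℓ
  PreservedBy f (h , _) = h ⟨$⟩ f ≈ f ⟨$⟩ (λ i → h ⟨$⟩ π i)

  evaluateAt : ∀ {m n} (g : Op m) → (m , g) ∈ Basic ^⊥ →
               (Fin n → Fin m → Carrier) → Hom (powerAlgebra 𝔸 (setoid ^ n)) 𝔸
  evaluateAt g g∈ x =
      record
        { to   = λ q → g ⟨$⟩ (λ j → q ⟨$⟩ (λ i → x i j))
        ; cong = λ q≈r → Func.cong g (λ j → q≈r _)
        }
    , λ σ q → sym (g∈ _ (basic σ {⟦ σ ⟧} (λ _ → refl)) _)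

  -- Evaluating `π i` at the columns of `x` returns row `i`, so preservation by `evaluateAt g g∈ x`
  -- unfolds to commutation at `x`.
  preserved⇒⊥⊥ : ∀ {n} (f : Op n) → (∀ h → PreservedBy f h) →
                 (n , f) ∈ Basic ^⊥⊥
  preserved⇒⊥⊥ f f-preserved (m , g) g∈ x = f-preserved (evaluateAt g g∈ x)

  ⊥⊥⇒preserved : IsFinite setoid → ∀ {n} (f : Op n) → (n , f) ∈ Basic ^⊥⊥ →
                 ∀ h → PreservedBy f h
  ⊥⊥⇒preserved finite {n} f f∈ (h , h-hom) =
    -- Column `c` of the matrix is the tuple `I.to c`. Since `I.to (I.from t)` equals `t`,
    -- reindexing the values of `f` on the columns gives back `f`, and reindexing row `i` gives back
    -- `π i`.
    trans (Func.cong h (λ t → Func.cong f (λ i → sym (I.strictlyInverseˡ t i))))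
      (trans (f∈ (N , g) g∈ (λ i c → I.to c i))
        (Func.cong f (λ i → Func.cong h (λ t → I.strictlyInverseˡ t i))))
    where
    A^n-finite = ^-isFinite setoid finite n
    N = proj₁ A^n-finite
    module I = Inverse (proj₂ A^n-finite)

    reindex : (Fin N → Carrier) → Op n
    reindex y = record
      { to   = λ t → y (I.from t)
      ; cong = λ t≈u → Setoid.reflexive setoid (≡.cong y (I.from-cong t≈u))
      }

    -- This is `h` transported along the bijection between A^N and A^(A^n).
    g : Op N
    g = record
      { to   = λ y → h ⟨$⟩ reindex y
      ; cong = λ y≈z → Func.cong h (λ t → y≈z (I.from t))
      }

    g∈ : (N , g) ∈ Basic ^⊥
    g∈ _ (basic σ σ≈f) x =
      -- Members of `Basic` are basic operations only up to pointwise equality, so `f` is exchanged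
      -- for `⟦ σ ⟧` and back around `h-hom`. Reindexing respects the pointwise operations
      -- definitionally.
      trans (sym (σ≈f _))
        (trans (sym (h-hom σ (λ j → reindex (λ c → x c j))))
          (Func.cong h (λ t → σ≈f _)))

corollary6p7 : ∀ {s a ℓ} → ExcludedMiddle (s ⊔ a ⊔ ℓ) →
    (S : Signature s) (𝔸 : Algebra S a ℓ) →
    let open Algebra 𝔸 in
    IsFinite setoid →
    (Basic ^⊥⊥ ≐ Clone⟨ Basic ⟩)
    ⇔
    (∀ {n} (f : Op n) → (n , f) ∉ Clone⟨ Basic ⟩ →
    Σ[ h ∈ Hom (powerAlgebra 𝔸 (setoid ^ n)) 𝔸 ]
    ¬ (proj₁ h ⟨$⟩ f ≈ f ⟨$⟩ (λ i → proj₁ h ⟨$⟩ π i)))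
corollary6p7 {s} {a} {ℓ} em S 𝔸 finite = record
  -- The witness `h` is obtained by contradiction: if none separates, every `h` preserves `f`.
  -- Preservation lives in level `ℓ`, hence the `Lift` before `em` applies.
  { to = λ (⊥⊥⊆Clone , _) f f∉ → decidable-stable em λ no-separating →
      f∉ (⊥⊥⊆Clone (preserved⇒⊥⊥ 𝔸 f λ h →
        decidable-stable (map′ lower lift (em {Lift (s ⊔ a) _}))
          λ ¬preserved → no-separating (h , ¬preserved)))
  ; from = λ separate →
        (λ {(_ , f)} f∈⊥⊥ → decidable-stable em λ f∉ →
          let h , ¬preserved = separate f f∉ in
          ¬preserved (⊥⊥⇒preserved 𝔸 finite f f∈⊥⊥ h))
      , Clone⊆⊥⊥ setoid Basic
  ; to-cong   = λ { ≡.refl → ≡.refl }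
  ; from-cong = λ { ≡.refl → ≡.refl }
  }
  where open Algebra 𝔸
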